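{- Let $\mathcal{M}$ be a monoid generated by a finite set $G'$, and suppose the word problem for $\mathcal{M}$ (with respect to $G'$) is decidable. Then $\mathcal{R}((\mathcal{M},G'))\subseteq\mathrm{RE}$, where $\mathrm{RE}$ is the class of recursively enumerable languages.
   Context: For a monoid $\mathcal{M}$ generated by a finite set $G'=\{g_1,\dots,g_n\}$, the monoid memory model $(\mathcal{M},G')$ is the Cayley graph: cells are the elements of $\mathcal{M}$, the initial cell is the identity, and for each $x\in\mathcal{M}$ and each $g_k$ there is an edge $x\to xg_k$ marked $g_k$. An $h$-head automaton with auxiliary memory of model $M$ has a finite state set, input alphabet with endmarkers, a finite memory alphabet $\Delta$, a transition function mapping (state, the $h$ symbols under its 2-way read-only input heads, the current memory symbol) to (new state, a move in $\{ -1,0,+1\}$ per head, and a mark to follow from the current cell or "stay"), an initial state and accepting states; it starts with heads at the leftmost input symbol and memory at the initial cell and runs deterministically for a fixed memory content $\mu\colon M\to\Delta$. It accepts $w$ iff for some $\mu$ it reaches an accepting state; $\mathcal{R}(M)$ is the class of languages so recognized. -}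

module Defs where

open import Level using (Level; _⊔_)
open import Algebra.Bundles using (Monoid)
open import Data.Nat using (ℕ; zero; suc; _≤ᵇ_)
open import Data.Fin using (Fin)
open import Data.Bool using (Bool; true; false; if_then_else_)
open import Data.List using (List; []; _∷_; length; foldl)
open import Data.Maybe using (Maybe; just; nothing)
open import Data.Vec using (Vec; zipWith; map)
open import Data.Product using (Σ; ∃; _×_; _,_; proj₁)
open import Relation.Nullary using (Dec)
open import Relation.Binary.PropositionalEquality using (_≡_)
open import Function using (_⇔_)

module _ {c ℓ : Level} (M : Monoid c ℓ) where
  open Monoid M

  eval : {n : ℕ} → (Fin n → Carrier) → List (Fin n) → Carrier
  eval g ws = foldl (λ x k → x ∙ g k) ε ws

  Generates : {n : ℕ} → (Fin n → Carrier) → Set (c ⊔ ℓ)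
  Generates {n} g = (x : Carrier) → Σ (List (Fin n)) (λ u → eval g u ≈ x)

  DecidableWordProblem : {n : ℕ} → (Fin n → Carrier) → Set ℓ
  DecidableWordProblem {n} g = (u v : List (Fin n)) → Dec (eval g u ≈ eval g v)

data TapeSym (s : ℕ) : Set where
  ⊢ ⊣ : TapeSym s
  sym : Fin s → TapeSym s

data Move : Set where
  left stay right : Move

-- h-head automaton with auxiliary memory on the Cayley graph with n marks;
-- q states, input alphabet Fin s, memory alphabet Fin d.
record Automaton (n h s : ℕ) : Set where
  field
    q d       : ℕ
    δ         : Fin q → Vec (TapeSym s) h → Fin d
                → Fin q × Vec Move h × Maybe (Fin n)   -- nothing = "stay"
    q₀        : Fin q
    accepting : Fin q → Bool

-- tape ⊢ w ⊣ : position 0 is ⊢, positions 1..|w| hold w, |w|+1 is ⊣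
readTape : {s : ℕ} → List (Fin s) → ℕ → TapeSym s
readTape w zero = ⊢
readTape [] (suc p) = ⊣
readTape (a ∷ w) (suc zero) = sym a
readTape (a ∷ w) (suc (suc p)) = readTape w (suc p)

moveHead : {s : ℕ} → List (Fin s) → Move → ℕ → ℕ
moveHead w left zero = zero
moveHead w left (suc p) = p
moveHead w stay p = p
moveHead w right p = if suc p ≤ᵇ suc (length w) then suc p else p

module _ {c ℓ : Level} (M : Monoid c ℓ) {n : ℕ} (g : Fin n → Monoid.Carrier M) where
  open Monoid M

  module Run {h s : ℕ} (A : Automaton n h s) (w : List (Fin s)) where
    open Automaton A

    record Config : Set c where
      constructor conf
      field
        state : Fin q
        heads : Vec ℕ h
        cell  : Carrier

    followMark : Carrier → Maybe (Fin n) → Carrier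
    followMark x nothing  = x
    followMark x (just k) = x ∙ g k

    step : (Carrier → Fin d) → Config → Config
    step μ (conf st hs x) with δ st (map (readTape w) hs) (μ x)
    ... | st' , mv , mk = conf st' (zipWith (moveHead w) mv hs) (followMark x mk)

    run : (Carrier → Fin d) → ℕ → Config
    run μ zero    = conf q₀ (Data.Vec.replicate h 1) ε
    run μ (suc t) = step μ (run μ t)

    -- memory contents: functions on the cells (elements of M), respecting ≈
    MemoryContent : Set (c ⊔ ℓ)
    MemoryContent = Σ (Carrier → Fin d) (λ μ → ∀ {x y} → x ≈ y → μ x ≡ μ y)

    Accepts : Set (c ⊔ ℓ)
    Accepts = Σ MemoryContent (λ μ → ∃ λ t →
                accepting (Config.state (run (proj₁ μ) t)) ≡ true)

  InR : {p : Level} {s : ℕ} → (List (Fin s) → Set p) → Set (c ⊔ ℓ ⊔ p)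
  InR {s = s} L = Σ ℕ λ h → Σ (Automaton n h s) λ A →
                    (w : List (Fin s)) → L w ⇔ Run.Accepts A w

-- Recursively enumerable languages: there is a (total, hence computable)
-- semi-decision procedure accepting exactly the words of L.
IsRE : {p : Level} {s : ℕ} → (List (Fin s) → Set p) → Set p
IsRE {s = s} L = Σ (List (Fin s) → ℕ → Bool) λ semi →
                   (w : List (Fin s)) → L w ⇔ (∃ λ t → semi w t ≡ true)

-- An accepting computation of length t is determined by the t memory
-- symbols it reads.  Conversely, any guessed sequence of t symbols determines
-- a "guessed run" of the automaton; it is the run of a genuine memory content
-- exactly when the guesses are consistent, i.e. whenever the run visits two
-- equal cells it has guessed the same symbol for both.  Because equality of
-- cells is decidable (word problem + generation), consistency is decidable,
-- and a consistent finite table of guesses extends to a memory content.  So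
-- "some consistent guessed run of length t accepts" is a decidable property
-- of (w , t), and w is accepted iff it holds for some t: a semi-decision.
module Submission where

open import Defs using (Generates; DecidableWordProblem; Automaton; module Run; InR; IsRE)
open import Level using (Level; _⊔_)
open import Algebra.Bundles using (Monoid)
open import Data.Nat using (ℕ; zero; suc)
open import Data.Nat.GeneralisedArithmetic using (fold; iterate; iterate-is-fold)
open import Data.Fin using (Fin)
import Data.Fin as Fin
import Data.Fin.Properties as Fin
open import Data.Bool using (true)
import Data.Bool.Properties as Bool
open import Data.List using (List; []; _∷_)
open import Data.List.Relation.Unary.All as All using (All; []; _∷_; all?)
open import Data.List.Relation.Unary.Any using (here; there)
open import Data.List.Membership.Propositional using (_∈_)
open import Data.Vec using (Vec; []; _∷_)
import Data.Vec
open import Data.Product using (∃; _×_; _,_; proj₁; proj₂)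
open import Function using (_⇔_; mk⇔; Equivalence; const)
open import Relation.Nullary using (Dec; yes; no; does; contradiction)
open import Relation.Nullary.Decidable using (_×-dec_; _→-dec_; map′; dec-true)
open import Relation.Unary using (Pred)
open import Relation.Binary using (Setoid; _Preserves_⟶_; Decidable; DecidableEquality)
open import Relation.Binary.PropositionalEquality as ≡ using (_≡_)

≈-decidable : {c ℓ : Level} (M : Monoid c ℓ) {n : ℕ} (g : Fin n → Monoid.Carrier M)
            → Generates M g → DecidableWordProblem M g → Decidable (Monoid._≈_ M)
≈-decidable M g gen dwp x y with gen x | gen y
... | u , u≈x | v , v≈y with dwp u v
...   | yes u≈v = yes (M.trans (M.sym u≈x) (M.trans u≈v v≈y))
  where module M = Monoid M
...   | no u≉v  = no (λ x≈y → u≉v (M.trans u≈x (M.trans x≈y (M.sym v≈y))))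
  where module M = Monoid M

-- A table is the graph of a ≈-respecting function iff it is
-- consistent (≈-equal arguments carry equal values); this is what lets a
-- guessed run be realised by a genuine memory content.

module Tables {a ℓ b : Level} (S : Setoid a ℓ) (_≈?_ : Decidable (Setoid._≈_ S))
              {B : Set b} (_≟_ : DecidableEquality B) where
  open Setoid S renaming (Carrier to A)

  Table : Set (a ⊔ b)
  Table = List (A × B)

  Consistent : Table → Set (a ⊔ ℓ ⊔ b)
  Consistent T = All (λ p → All (λ q → proj₁ p ≈ proj₁ q → proj₂ p ≡ proj₂ q) T) T

  consistent? : (T : Table) → Dec (Consistent T)
  consistent? T =
    all? (λ p → all? (λ q → (proj₁ p ≈? proj₁ q) →-dec (proj₂ p ≟ proj₂ q)) T) T

  Agrees : (A → B) → Table → Set (a ⊔ b)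
  Agrees f T = All (λ p → f (proj₁ p) ≡ proj₂ p) T

  agrees⇒consistent : (f : A → B) → f Preserves _≈_ ⟶ _≡_
                    → (T : Table) → Agrees f T → Consistent T
  agrees⇒consistent f resp T fT =
    All.map (λ fp≡ → All.map (λ fq≡ p≈q → ≡.trans (≡.sym fp≡) (≡.trans (resp p≈q) fq≡)) fT) fT

  lookup : B → Table → A → B
  lookup b₀ [] x = b₀
  lookup b₀ ((z , e) ∷ T) x with z ≈? x
  ... | yes _ = e
  ... | no  _ = lookup b₀ T x

  lookup-resp : (b₀ : B) (T : Table) → lookup b₀ T Preserves _≈_ ⟶ _≡_
  lookup-resp b₀ [] x≈y = ≡.refl
  lookup-resp b₀ ((z , e) ∷ T) {x} {y} x≈y with z ≈? x | z ≈? y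
  ... | yes _   | yes _   = ≡.refl
  ... | yes z≈x | no  z≉y = contradiction (trans z≈x x≈y) z≉y
  ... | no  z≉x | yes z≈y = contradiction (trans z≈y (sym x≈y)) z≉x
  ... | no  _   | no  _   = lookup-resp b₀ T x≈y

  lookup-entry : (b₀ : B) (T : Table) {y : A} {e : B} → (y , e) ∈ T
               → All (λ q → proj₁ q ≈ y → proj₂ q ≡ e) T → lookup b₀ T y ≡ e
  lookup-entry b₀ ((z , _) ∷ T) {y} y∈T (z~y ∷ T~y) with z ≈? y | y∈T
  ... | yes z≈y | _          = z~y z≈y
  ... | no  z≉y | here ≡.refl = contradiction refl z≉y
  ... | no  _   | there y∈T′ = lookup-entry b₀ T y∈T′ T~y

  consistent⇒agrees : (b₀ : B) (T : Table) → Consistent T → Agrees (lookup b₀ T) T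
  consistent⇒agrees b₀ T cons = All.tabulate (λ p∈T →
    lookup-entry b₀ T p∈T (All.tabulate (λ q∈T q≈p → All.lookup (All.lookup cons q∈T) p∈T q≈p)))

any-vec? : {p : Level} {k : ℕ} (t : ℕ) {P : Pred (Vec (Fin k) t) p}
         → ((v : Vec (Fin k) t) → Dec (P v)) → Dec (∃ P)
any-vec? zero    P? = map′ (λ p → [] , p) (λ { ([] , p) → p }) (P? [])
any-vec? (suc t) P? =
  map′ (λ (a , as , p) → a ∷ as , p) (λ { (a ∷ as , p) → a , as , p })
       (Fin.any? (λ a → any-vec? t (λ as → P? (a ∷ as))))

inhabited? : (k : ℕ) → Dec (Fin k)
inhabited? zero    = no (λ ())
inhabited? (suc k) = yes Fin.zero

module GuessedRuns {c ℓ : Level} (M : Monoid c ℓ) {n : ℕ} (g : Fin n → Monoid.Carrier M)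
                   (_≈?_ : Decidable (Monoid._≈_ M))
                   {h s : ℕ} (A : Automaton n h s) (w : List (Fin s)) where
  open Monoid M using (Carrier; _≈_; setoid)
  open Automaton A
  open Run M g A w
  open Tables setoid _≈?_ (Fin._≟_ {d})

  initial : Config
  initial = conf q₀ (Data.Vec.replicate h 1) (Monoid.ε M)

  replay : {t : ℕ} → Config → Vec (Fin d) t → Config
  replay cf []       = cf
  replay cf (a ∷ as) = replay (step (const a) cf) as

  history : {t : ℕ} → Config → Vec (Fin d) t → Table
  history cf []       = []
  history cf (a ∷ as) = (Config.cell cf , a) ∷ history (step (const a) cf) as

  observed : (Carrier → Fin d) → Config → (t : ℕ) → Vec (Fin d) t
  observed μ cf zero    = []
  observed μ cf (suc t) = μ (Config.cell cf) ∷ observed μ (step μ cf) t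

  -- runs step at the end, replays at the front; both are iteration of step μ
  run-iterate : (μ : Carrier → Fin d) (t : ℕ) → run μ t ≡ iterate (step μ) initial t
  run-iterate μ t = ≡.trans (run-fold t) (iterate-is-fold initial (step μ) t)
    where
    run-fold : (t : ℕ) → run μ t ≡ fold initial (step μ) t
    run-fold zero    = ≡.refl
    run-fold (suc t) = ≡.cong (step μ) (run-fold t)

  replay-agrees : (μ : Carrier → Fin d) {t : ℕ} (cf : Config) (as : Vec (Fin d) t)
                → Agrees μ (history cf as) → replay cf as ≡ iterate (step μ) cf t
  replay-agrees μ cf []       []         = ≡.refl
  replay-agrees μ {suc t} cf (a ∷ as) (μa≡ ∷ μH) = begin
    replay (step (const a) cf) as              ≡⟨ replay-agrees μ _ as μH ⟩
    iterate (step μ) (step (const a) cf) t     ≡⟨ ≡.cong (λ cf′ → iterate (step μ) cf′ t) step-eq ⟩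
    iterate (step μ) (step μ cf) t             ∎
    where
    open ≡.≡-Reasoning
    step-eq : step (const a) cf ≡ step μ cf
    step-eq = ≡.cong (λ b → step (const b) cf) (≡.sym μa≡)

  observed-agrees : (μ : Carrier → Fin d) (cf : Config) (t : ℕ)
                  → Agrees μ (history cf (observed μ cf t))
  observed-agrees μ cf zero    = []
  observed-agrees μ cf (suc t) = ≡.refl ∷ observed-agrees μ (step μ cf) t

  AcceptingGuess : (t : ℕ) → Vec (Fin d) t → Set (c ⊔ ℓ)
  AcceptingGuess t as = Consistent (history initial as)
                      × accepting (Config.state (replay initial as)) ≡ true

  -- certificate of acceptance at time t; a memory symbol is needed to
  -- fill the cells the run never visits
  Certified : ℕ → Set (c ⊔ ℓ)
  Certified t = Fin d × ∃ (AcceptingGuess t)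

  certified? : (t : ℕ) → Dec (Certified t)
  certified? t = inhabited? d ×-dec any-vec? t guess?
    where
    guess? : (as : Vec (Fin d) t) → Dec (AcceptingGuess t as)
    guess? as = consistent? (history initial as)
              ×-dec (accepting (Config.state (replay initial as)) Bool.≟ true)

  -- an accepting run certifies itself: guess the symbols it actually reads,
  -- and use the symbol at the identity as the filler
  accepts⇒certified : Accepts → ∃ Certified
  accepts⇒certified ((μ , resp) , t , acc) =
    t , μ (Monoid.ε M) , observed μ initial t ,
    agrees⇒consistent μ resp _ μH , ≡.trans (≡.cong (λ cf → accepting (Config.state cf)) same) acc
    where
    μH : Agrees μ (history initial (observed μ initial t))
    μH = observed-agrees μ initial t
    same : replay initial (observed μ initial t) ≡ run μ t
    same = ≡.trans (replay-agrees μ initial _ μH) (≡.sym (run-iterate μ t))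

  -- a certificate is realised by the memory content read off its history
  certified⇒accepts : (t : ℕ) → Certified t → Accepts
  certified⇒accepts t (b₀ , as , cons , acc) =
    (μ , lookup-resp b₀ H) , t ,
    ≡.trans (≡.cong (λ cf → accepting (Config.state cf)) same) acc
    where
    H : Table
    H = history initial as
    μ : Carrier → Fin d
    μ = lookup b₀ H
    same : run μ t ≡ replay initial as
    same = ≡.trans (run-iterate μ t) (≡.sym (replay-agrees μ initial as (consistent⇒agrees b₀ H cons)))

union⇔test : {p : Level} {P : ℕ → Set p} (P? : (t : ℕ) → Dec (P t))
           → ∃ P ⇔ (∃ λ t → does (P? t) ≡ true)
union⇔test {P = P} P? = mk⇔ (λ (t , pt) → t , dec-true (P? t) pt) from
  where
  from : ∃ (λ t → does (P? t) ≡ true) → ∃ P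
  from (t , test) with P? t
  ... | yes pt = t , pt
  from (t , ())   | no _

theorem7 : {c ℓ p : Level} (M : Monoid c ℓ) (n : ℕ) (g : Fin n → Monoid.Carrier M)
           → Generates M g → DecidableWordProblem M g
           → (s : ℕ) (L : List (Fin s) → Set p)
           → InR M g L → IsRE L
theorem7 M n g gen dwp s L (h , A , L⇔accepts) =
  (λ w t → does (GR.certified? w t)) , λ w → mk⇔
    (λ w∈L → to (union⇔test (GR.certified? w)) (GR.accepts⇒certified w (to (L⇔accepts w) w∈L)))
    (λ test → let (t , cert) = from (union⇔test (GR.certified? w)) test
              in from (L⇔accepts w) (GR.certified⇒accepts w t cert))
  where
  open Equivalence
  module GR (w : List (Fin s)) = GuessedRuns M g (≈-decidable M g gen dwp) A w
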